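{- Let $K_{p,p}$ be the complete bipartite graph with both parts of size $p$. The immorality number of $K_{p,p}$ is $m(K_{p,p})=p\binom{p}{2}$.
   Context: An immorality of a directed acyclic graph (DAG) is an induced subgraph of the form $X\to Z\leftarrow Y$ (with $X,Y$ not adjacent). The immorality number $m(G)$ of an undirected graph $G$ is the maximum number of immoralities over all DAGs whose skeleton (underlying undirected graph) is $G$. -}

module Defs where

open import Data.Empty using (⊥)
open import Data.Fin.Base using (Fin; _<_; splitAt)
open import Data.Fin.Properties using (_<?_)
open import Data.List.Base using (List; allFin; cartesianProduct; filter; length)
open import Data.Nat.Base using (ℕ; _+_; _≤_)
open import Data.Product.Base using (_×_; _,_; ∃-syntax)
open import Data.Sum.Base using (_⊎_; inj₁; inj₂; map; reduce; swap)
open import Data.Unit.Base using (⊤; tt)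
open import Function.Base using (_∘_)
open import Function.Bundles using (_⇔_)
open import Level using (0ℓ)
open import Relation.Binary.Construct.Closure.Transitive using (TransClosure; [_])
open import Relation.Binary.Core using (Rel)
open import Relation.Binary.Definitions using (Decidable; Irreflexive; Symmetric)
open import Relation.Binary.PropositionalEquality.Core using (_≡_; refl)
open import Relation.Nullary.Decidable.Core using (Dec; yes; no; _×-dec_; _⊎-dec_; ¬?)
open import Relation.Nullary.Negation.Core using (¬_)

-- Finite simple graphs and DAGs on n labelled vertices.  Edge relations are
-- decidable so that immoralities can be counted.

record Graph (n : ℕ) : Set₁ where
  field
    Adjacent    : Rel (Fin n) 0ℓ
    adjacent?   : Decidable Adjacent
    symmetric   : Symmetric Adjacent
    irreflexive : Irreflexive _≡_ Adjacent

-- Acyclicity forbids loops and pairs of opposite edges as well.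

record DAG (n : ℕ) : Set₁ where
  infix 4 _⟶_
  field
    _⟶_     : Rel (Fin n) 0ℓ
    _⟶?_    : Decidable _⟶_
    acyclic : ∀ x → ¬ TransClosure _⟶_ x x

skeleton : ∀ {n} → DAG n → Graph n
skeleton D = record
  { Adjacent    = λ x y → (x ⟶ y) ⊎ (y ⟶ x)
  ; adjacent?   = λ x y → (x ⟶? y) ⊎-dec (y ⟶? x)
  ; symmetric   = swap
  ; irreflexive = λ { {x} refl → reduce ∘ map (acyclic x ∘ [_]) (acyclic x ∘ [_]) }
  }
  where open DAG D

infix 4 _≈ᴳ_

_≈ᴳ_ : ∀ {n} → Graph n → Graph n → Set
G ≈ᴳ H = ∀ x y → Graph.Adjacent G x y ⇔ Graph.Adjacent H x y

module _ {n : ℕ} (D : DAG n) where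
  open DAG D
  open Graph (skeleton D) using (Adjacent; adjacent?)

  -- (x , y , z) stands for x ⟶ z ⟵ y.  Requiring x < y picks one of the two
  -- triples that describe the same induced subgraph, and makes x and y distinct.

  IsImmorality : Fin n × Fin n × Fin n → Set
  IsImmorality (x , y , z) = x < y × x ⟶ z × y ⟶ z × ¬ Adjacent x y

  isImmorality? : ∀ t → Dec (IsImmorality t)
  isImmorality? (x , y , z) =
    (x <? y) ×-dec (x ⟶? z) ×-dec (y ⟶? z) ×-dec ¬? (adjacent? x y)

  immoralities : List (Fin n × Fin n × Fin n)
  immoralities =
    filter isImmorality? (cartesianProduct (allFin n) (cartesianProduct (allFin n) (allFin n)))

  #immoralities : ℕ
  #immoralities = length immoralities

-- m(G) = k: the maximum of #immoralities over DAGs with skeleton G is attained and equals k.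

ImmoralityNumber : ∀ {n} → Graph n → ℕ → Set₁
ImmoralityNumber {n} G k =
    (∃[ D ] skeleton D ≈ᴳ G × #immoralities D ≡ k)
  × (∀ (D : DAG n) → skeleton D ≈ᴳ G → #immoralities D ≤ k)

OppositeParts : {A B : Set} → Rel (A ⊎ B) 0ℓ
OppositeParts (inj₁ _) (inj₁ _) = ⊥
OppositeParts (inj₁ _) (inj₂ _) = ⊤
OppositeParts (inj₂ _) (inj₁ _) = ⊤
OppositeParts (inj₂ _) (inj₂ _) = ⊥

oppositeParts? : {A B : Set} → Decidable (OppositeParts {A} {B})
oppositeParts? (inj₁ _) (inj₁ _) = no λ ()
oppositeParts? (inj₁ _) (inj₂ _) = yes tt
oppositeParts? (inj₂ _) (inj₁ _) = yes tt
oppositeParts? (inj₂ _) (inj₂ _) = no λ ()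

oppositeParts-sym : {A B : Set} → Symmetric (OppositeParts {A} {B})
oppositeParts-sym {x = inj₁ _} {y = inj₂ _} _ = tt
oppositeParts-sym {x = inj₂ _} {y = inj₁ _} _ = tt

oppositeParts-irrefl : {A B : Set} → Irreflexive _≡_ (OppositeParts {A} {B})
oppositeParts-irrefl {x = inj₁ _} refl ()
oppositeParts-irrefl {x = inj₂ _} refl ()

-- The parts are the first p and the last q vertices.

K[_,_] : ∀ p q → Graph (p + q)
K[ p , q ] = record
  { Adjacent    = λ x y → OppositeParts (splitAt p x) (splitAt p y)
  ; adjacent?   = λ x y → oppositeParts? (splitAt p x) (splitAt p y)
  ; symmetric   = λ {x} {y} → oppositeParts-sym {x = splitAt p x} {y = splitAt p y}
  ; irreflexive = λ { {x} refl → oppositeParts-irrefl {x = splitAt p x} refl }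
  }

module Submission where

-- Orient K_{p,p} arbitrarily, with indicators E x z of x ⟶ z.  From 2ab ≤ a + b for a, b ∈ {0, 1},
-- twice the number of immoralities is at most the sum of E x z + E y z over all z and all
-- nonadjacent pairs x < y.  In a d-regular graph on n vertices every x has n - 1 - d nonneighbours
-- other than itself, so this sum is (n - 1 - d) times the number n d / 2 of edges, whatever the
-- orientation.  Equality holds when nonadjacent vertices have the same out-neighbours, as they do
-- when all edges of K_{p,p} point from the first part to the second.

open import Defs
open import Data.Bool.Base using (if_then_else_)
open import Data.Fin.Base using (Fin; zero; suc; splitAt; _<_)
open import Data.Fin.Properties using (_<?_; _≟_; <-cmp)
open import Data.List.Base
  using (List; []; _∷_; _++_; allFin; cartesianProduct; filter; length; map; tabulate)
open import Data.List.Properties using (filter-++; length-++)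
open import Data.Nat.Base using (ℕ; zero; suc; _+_; _*_; _∸_; _≤_; z≤n)
open import Data.Nat.Combinatorics using (_C_; nCk+nC[k+1]≡[n+1]C[k+1]; nC1≡n)
open import Data.Nat.Properties
  using ( +-*-semiring; +-identityʳ; +-mono-≤; +-assoc; *-cancelˡ-≤; *-cancelˡ-≡; *-identityʳ
        ; *-zeroʳ; *-distribʳ-+; ≤-refl; m+n∸n≡m; module ≤-Reasoning)
open import Data.Nat.Tactic.RingSolver using (solve-∀)
open import Data.Product.Base using (_×_; _,_; proj₁)
open import Data.Sum.Base as Sum using (_⊎_; inj₁; inj₂)
open import Data.Unit.Base using (⊤; tt)
open import Data.Empty using (⊥; ⊥-elim)
open import Function.Base using (_∘_; id)
open import Function.Bundles using (_⇔_; mk⇔; Equivalence)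
open import Level using (0ℓ)
open import Relation.Binary.Construct.Closure.Transitive using (TransClosure; [_]; _∷_)
open import Relation.Binary.Core using (Rel)
open import Relation.Binary.Definitions using (Decidable; Tri; tri<; tri≈; tri>)
open import Relation.Binary.PropositionalEquality
  using (_≡_; refl; sym; trans; cong; cong₂; module ≡-Reasoning)
open import Relation.Nullary.Decidable
  using (Dec; yes; no; does; _×-dec_; _⊎-dec_; ¬?; dec-true; dec-false; does-⇔)
open import Relation.Nullary.Negation using (¬_)
open import Relation.Unary using (Pred) renaming (Decidable to Decidable₁)

open import Algebra.Properties.Semiring.Sum +-*-semiring
  using (sum; sum-syntax; sum-cong-≗; ∑-distrib-+; ∑-comm; *-distribˡ-sum; *-distribʳ-sum)

private
  variable
    A B X Y : Set
    n : ℕ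

-- Indicators of decidable propositions.

𝟙 : Dec A → ℕ
𝟙 a? = if does a? then 1 else 0

𝟙-true : (a? : Dec A) → A → 𝟙 a? ≡ 1
𝟙-true a? a = cong (if_then 1 else 0) (dec-true a? a)

𝟙-false : (a? : Dec A) → ¬ A → 𝟙 a? ≡ 0
𝟙-false a? ¬a = cong (if_then 1 else 0) (dec-false a? ¬a)

𝟙-⇔ : A ⇔ B → (a? : Dec A) (b? : Dec B) → 𝟙 a? ≡ 𝟙 b?
𝟙-⇔ A⇔B a? b? = cong (if_then 1 else 0) (does-⇔ A⇔B a? b?)

𝟙-⊎ : (a? : Dec A) (b? : Dec B) → ¬ (A × B) → 𝟙 (a? ⊎-dec b?) ≡ 𝟙 a? + 𝟙 b?
𝟙-⊎ (yes a) (yes b) ¬ab = ⊥-elim (¬ab (a , b))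
𝟙-⊎ (yes _) (no  _) _   = refl
𝟙-⊎ (no  _) (yes _) _   = refl
𝟙-⊎ (no  _) (no  _) _   = refl

-- The inequality for a single triple. The factors stand in the order of `IsImmorality`, so the left
-- indicator is that of `isImmorality?` by computation and `𝟙 (a? ×-dec b?)` becomes the weight of a
-- nonadjacent pair.
2𝟙-×-≤ : (a? : Dec A) (b? : Dec B) (x? : Dec X) (y? : Dec Y) →
         2 * 𝟙 (a? ×-dec x? ×-dec y? ×-dec b?) ≤ 𝟙 (a? ×-dec b?) * 𝟙 x? + 𝟙 (a? ×-dec b?) * 𝟙 y?
2𝟙-×-≤ (no  _) _       _       _       = z≤n
2𝟙-×-≤ (yes _) _       (no  _) _       = z≤n
2𝟙-×-≤ (yes _) _       (yes _) (no  _) = z≤n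
2𝟙-×-≤ (yes _) (no  _) (yes _) (yes _) = z≤n
2𝟙-×-≤ (yes _) (yes _) (yes _) (yes _) = ≤-refl

-- Two bits `a`, `b` satisfy `2ab = a + b` exactly when they agree. Agreement is asked only under
-- `B`, since otherwise both sides vanish.
2𝟙-×-≡ : (a? : Dec A) (b? : Dec B) (x? : Dec X) (y? : Dec Y) → (B → X ⇔ Y) →
         2 * 𝟙 (a? ×-dec x? ×-dec y? ×-dec b?) ≡ 𝟙 (a? ×-dec b?) * 𝟙 x? + 𝟙 (a? ×-dec b?) * 𝟙 y?
2𝟙-×-≡ (no  _) _       _       _       _ = refl
2𝟙-×-≡ (yes _) (no  _) (no  _) _       _ = refl
2𝟙-×-≡ (yes _) (no  _) (yes _) (no  _) _ = refl
2𝟙-×-≡ (yes _) (no  _) (yes _) (yes _) _ = refl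
2𝟙-×-≡ (yes _) (yes _) (yes _) (yes _) _ = refl
2𝟙-×-≡ (yes _) (yes _) (no  _) (no  _) _ = refl
2𝟙-×-≡ (yes _) (yes b) (yes x) (no ¬y) e = ⊥-elim (¬y (Equivalence.to (e b) x))
2𝟙-×-≡ (yes _) (yes b) (no ¬x) (yes y) e = ⊥-elim (¬x (Equivalence.from (e b) y))

-- Finite sums of natural numbers.

sum-mono-≤ : {f g : Fin n → ℕ} → (∀ i → f i ≤ g i) → sum f ≤ sum g
sum-mono-≤ {zero}  _   = z≤n
sum-mono-≤ {suc n} f≤g = +-mono-≤ (f≤g zero) (sum-mono-≤ (f≤g ∘ suc))

sum-const : ∀ n c → ∑[ i < n ] c ≡ n * c
sum-const zero    c = refl
sum-const (suc n) c = cong (c +_) (sum-const n c)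

sum-𝟙-≟ : (x : Fin n) → ∑[ y < n ] 𝟙 (x ≟ y) ≡ 1
sum-𝟙-≟ {suc n} zero    = cong suc (trans (sum-const n 0) (*-zeroʳ n))
sum-𝟙-≟ {suc n} (suc x) = trans (sum-cong-≗ λ y → 𝟙-⇔ suc-⇔ (suc x ≟ suc y) (x ≟ y)) (sum-𝟙-≟ x)
  where
  suc-⇔ : ∀ {y} → (suc x ≡ suc y) ⇔ (x ≡ y)
  suc-⇔ = mk⇔ (λ { refl → refl }) (cong suc)

sum-splitAt : ∀ m {n} (f : Fin m ⊎ Fin n → ℕ) →
              ∑[ x < m + n ] f (splitAt m x) ≡ ∑[ i < m ] f (inj₁ i) + ∑[ j < n ] f (inj₂ j)
sum-splitAt zero    f = refl
sum-splitAt (suc m) f = trans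
  -- On `suc x`, `splitAt (suc m)` reduces to `splitAt m x` with its left values shifted, hence the
  -- change of `f`.
  (cong (f (inj₁ zero) +_) (sum-splitAt m (f ∘ Sum.map suc id)))
  (sym (+-assoc (f (inj₁ zero)) _ _))

-- Lengths of filtered lists as sums of indicators.

module _ {P : Pred A 0ℓ} (P? : Decidable₁ P) where

  length-filter-map : (f : B → A) (xs : List B) →
                      length (filter P? (map f xs)) ≡ length (filter (P? ∘ f) xs)
  length-filter-map f []       = refl
  length-filter-map f (x ∷ xs) with P? (f x)
  ... | yes _ = cong suc (length-filter-map f xs)
  ... | no  _ = length-filter-map f xs

  length-filter-tabulate : (f : Fin n → A) →
                           length (filter P? (tabulate f)) ≡ ∑[ i < n ] 𝟙 (P? (f i))
  length-filter-tabulate {zero}  f = refl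
  length-filter-tabulate {suc n} f with P? (f zero)
  ... | yes _ = cong suc (length-filter-tabulate (f ∘ suc))
  ... | no  _ = length-filter-tabulate (f ∘ suc)

-- A general `tabulate f` in place of `allFin n` lets the induction go through: the tail of
-- `allFin (suc n)` is `tabulate suc`.
length-filter-cartesianProduct :
  {P : Pred (A × B) 0ℓ} (P? : Decidable₁ P) (f : Fin n → A) (ys : List B) →
  length (filter P? (cartesianProduct (tabulate f) ys))
    ≡ ∑[ i < n ] length (filter (λ y → P? (f i , y)) ys)
length-filter-cartesianProduct {n = zero}  P? f ys = refl
length-filter-cartesianProduct {n = suc n} P? f ys = begin
  length (filter P? (row ++ rest))                     ≡⟨ cong length (filter-++ P? row rest) ⟩
  length (filter P? row ++ filter P? rest)             ≡⟨ length-++ (filter P? row) ⟩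
  length (filter P? row) + length (filter P? rest)     ≡⟨ cong₂ _+_
    (length-filter-map P? (f zero ,_) ys) (length-filter-cartesianProduct P? (f ∘ suc) ys) ⟩
  ∑[ i < suc n ] length (filter (λ y → P? (f i , y)) ys)   ∎
  where
  open ≡-Reasoning
  row  = map (f zero ,_) ys
  rest = cartesianProduct (tabulate (f ∘ suc)) ys

-- Nonadjacent pairs in regular graphs.

Regular : Graph n → ℕ → Set
Regular {n} G d = ∀ x → ∑[ y < n ] 𝟙 (Graph.adjacent? G x y) ≡ d

Regular-resp-≈ᴳ : {G H : Graph n} {d : ℕ} → G ≈ᴳ H → Regular H d → Regular G d
Regular-resp-≈ᴳ {G = G} {H} G≈H H-regular x = trans
  (sum-cong-≗ λ y → 𝟙-⇔ (G≈H x y) (Graph.adjacent? G x y) (Graph.adjacent? H x y))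
  (H-regular x)

module _ (G : Graph n) where
  open Graph G

  -- The part of `IsImmorality` that does not depend on the common head; the order on vertices makes
  -- each nonadjacent pair count once.
  nonedge? : ∀ x y → Dec (x < y × ¬ Adjacent x y)
  nonedge? x y = (x <? y) ×-dec ¬? (adjacent? x y)

  -- Four mutually exclusive cases exhaust all pairs. As an identity of indicators it can be summed
  -- over `y`.
  pair-trichotomy : ∀ x y →
    (𝟙 (nonedge? x y) + 𝟙 (nonedge? y x)) + (𝟙 (x ≟ y) + 𝟙 (adjacent? x y)) ≡ 1
  pair-trichotomy x y = cases (adjacent? x y) (<-cmp x y)
    where
    total : ℕ
    total = (𝟙 (nonedge? x y) + 𝟙 (nonedge? y x)) + (𝟙 (x ≟ y) + 𝟙 (adjacent? x y))

    split : ∀ {a b c d} → 𝟙 (nonedge? x y) ≡ a → 𝟙 (nonedge? y x) ≡ b →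
            𝟙 (x ≟ y) ≡ c → 𝟙 (adjacent? x y) ≡ d →
            total ≡ (a + b) + (c + d)
    split p q r s = cong₂ _+_ (cong₂ _+_ p q) (cong₂ _+_ r s)

    cases : Dec (Adjacent x y) → Tri (x < y) (x ≡ y) (y < x) →
            total ≡ 1
    cases (yes adj) _ = split
      (𝟙-false (nonedge? x y) λ (_ , ¬adj) → ¬adj adj)
      (𝟙-false (nonedge? y x) λ (_ , ¬adj) → ¬adj (symmetric adj))
      (𝟙-false (x ≟ y) λ x≡y → irreflexive x≡y adj)
      (𝟙-true (adjacent? x y) adj)
    cases (no ¬adj) (tri< x<y x≢y x≯y) = split
      (𝟙-true (nonedge? x y) (x<y , ¬adj))
      (𝟙-false (nonedge? y x) (x≯y ∘ proj₁))
      (𝟙-false (x ≟ y) x≢y)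
      (𝟙-false (adjacent? x y) ¬adj)
    cases (no ¬adj) (tri≈ x≮y x≡y x≯y) = split
      (𝟙-false (nonedge? x y) (x≮y ∘ proj₁))
      (𝟙-false (nonedge? y x) (x≯y ∘ proj₁))
      (𝟙-true (x ≟ y) x≡y)
      (𝟙-false (adjacent? x y) ¬adj)
    cases (no ¬adj) (tri> x≮y x≢y x>y) = split
      (𝟙-false (nonedge? x y) (x≮y ∘ proj₁))
      (𝟙-true (nonedge? y x) (x>y , ¬adj ∘ symmetric))
      (𝟙-false (x ≟ y) x≢y)
      (𝟙-false (adjacent? x y) ¬adj)

  -- The `n` vertices are `x`, its `d` neighbours and its nonneighbours. The two indicators catch
  -- the nonneighbours above and below `x`.
  nonneighbours-regular : ∀ {d} → Regular G d → ∀ x →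
    ∑[ y < n ] (𝟙 (nonedge? x y) + 𝟙 (nonedge? y x)) ≡ n ∸ suc d
  nonneighbours-regular {d} regular x = begin
    -- Since `sum N + suc d` is `n`, the truncated subtraction is exact.
    sum N                  ≡⟨ m+n∸n≡m (sum N) (suc d) ⟨
    sum N + suc d ∸ suc d  ≡⟨ cong (_∸ suc d) sum+suc≡n ⟩
    n ∸ suc d              ∎
    where
    open ≡-Reasoning
    N I J : Fin n → ℕ
    N y = 𝟙 (nonedge? x y) + 𝟙 (nonedge? y x)
    I y = 𝟙 (x ≟ y)
    J y = 𝟙 (adjacent? x y)
    sum+suc≡n : sum N + suc d ≡ n
    sum+suc≡n = begin
      sum N + (1 + d)                ≡⟨ cong (sum N +_) (cong₂ _+_ (sum-𝟙-≟ x) (regular x)) ⟨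
      sum N + (sum I + sum J)        ≡⟨ cong (sum N +_) (∑-distrib-+ I J) ⟨
      sum N + ∑[ y < n ] (I y + J y) ≡⟨ ∑-distrib-+ N (λ y → I y + J y) ⟨
      ∑[ y < n ] (N y + (I y + J y)) ≡⟨ sum-cong-≗ (pair-trichotomy x) ⟩
      ∑[ y < n ] 1                   ≡⟨ sum-const n 1 ⟩
      n * 1                          ≡⟨ *-identityʳ n ⟩
      n                              ∎

-- Immoralities and outdegrees.

module _ (D : DAG n) where
  open DAG D
  open Graph (skeleton D) using (Adjacent; adjacent?)

  private
    E W : Fin n → Fin n → ℕ
    E x z = 𝟙 (x ⟶? z)
    W x y = 𝟙 (nonedge? (skeleton D) x y)

  outdegree : Fin n → ℕ
  outdegree x = ∑[ z < n ] E x z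

  -- The upper bound for twice the number of immoralities, with the sum over heads `z` already
  -- carried out.
  nonedgeOutdegrees : ℕ
  nonedgeOutdegrees = ∑[ x < n ] ∑[ y < n ] (W x y * outdegree x + W x y * outdegree y)

  #immoralities-sum :
    #immoralities D ≡ ∑[ x < n ] ∑[ y < n ] ∑[ z < n ] 𝟙 (isImmorality? D (x , y , z))
  #immoralities-sum = trans
    (length-filter-cartesianProduct (isImmorality? D) id (cartesianProduct (allFin n) (allFin n)))
    (sum-cong-≗ λ x → trans
      (length-filter-cartesianProduct (λ yz → isImmorality? D (x , yz)) id (allFin n))
      (sum-cong-≗ λ y → length-filter-tabulate (λ z → isImmorality? D (x , y , z)) id))

  2*#immoralities-sum :
    2 * #immoralities D ≡ ∑[ x < n ] ∑[ y < n ] ∑[ z < n ] (2 * 𝟙 (isImmorality? D (x , y , z)))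
  2*#immoralities-sum = begin
    2 * #immoralities D                            ≡⟨ cong (2 *_) #immoralities-sum ⟩
    2 * ∑[ x < n ] ∑[ y < n ] ∑[ z < n ] imm x y z
      ≡⟨ *-distribˡ-sum 2 (λ x → ∑[ y < n ] ∑[ z < n ] imm x y z) ⟩
    ∑[ x < n ] (2 * ∑[ y < n ] ∑[ z < n ] imm x y z)
      ≡⟨ (sum-cong-≗ λ x → *-distribˡ-sum 2 (λ y → ∑[ z < n ] imm x y z)) ⟩
    ∑[ x < n ] ∑[ y < n ] (2 * ∑[ z < n ] imm x y z)
      ≡⟨ (sum-cong-≗ λ x → sum-cong-≗ λ y → *-distribˡ-sum 2 (imm x y)) ⟩
    ∑[ x < n ] ∑[ y < n ] ∑[ z < n ] (2 * imm x y z) ∎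
    where
    open ≡-Reasoning
    imm : Fin n → Fin n → Fin n → ℕ
    imm x y z = 𝟙 (isImmorality? D (x , y , z))

  nonedgeOutdegrees-sum :
    ∑[ x < n ] ∑[ y < n ] ∑[ z < n ] (W x y * E x z + W x y * E y z) ≡ nonedgeOutdegrees
  nonedgeOutdegrees-sum = sum-cong-≗ λ x → sum-cong-≗ λ y → trans
    (∑-distrib-+ (λ z → W x y * E x z) (λ z → W x y * E y z))
    (sym (cong₂ _+_ (*-distribˡ-sum (W x y) (E x)) (*-distribˡ-sum (W x y) (E y))))

  2*#immoralities≤nonedgeOutdegrees : 2 * #immoralities D ≤ nonedgeOutdegrees
  2*#immoralities≤nonedgeOutdegrees = begin
    2 * #immoralities D ≡⟨ 2*#immoralities-sum ⟩
    ∑[ x < n ] ∑[ y < n ] ∑[ z < n ] (2 * 𝟙 (isImmorality? D (x , y , z)))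
      ≤⟨ (sum-mono-≤ λ x → sum-mono-≤ λ y → sum-mono-≤ λ z →
            2𝟙-×-≤ (x <? y) (¬? (adjacent? x y)) (x ⟶? z) (y ⟶? z)) ⟩
    ∑[ x < n ] ∑[ y < n ] ∑[ z < n ] (W x y * E x z + W x y * E y z)
      ≡⟨ nonedgeOutdegrees-sum ⟩
    nonedgeOutdegrees ∎
    where open ≤-Reasoning

  -- For a nonadjacent pair, both vertices or neither point to a given `z`, so every term attains
  -- its bound.
  2*#immoralities≡nonedgeOutdegrees :
    (∀ x y z → ¬ Adjacent x y → (x ⟶ z) ⇔ (y ⟶ z)) → 2 * #immoralities D ≡ nonedgeOutdegrees
  2*#immoralities≡nonedgeOutdegrees twins = begin
    2 * #immoralities D ≡⟨ 2*#immoralities-sum ⟩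
    ∑[ x < n ] ∑[ y < n ] ∑[ z < n ] (2 * 𝟙 (isImmorality? D (x , y , z)))
      ≡⟨ (sum-cong-≗ λ x → sum-cong-≗ λ y → sum-cong-≗ λ z →
            2𝟙-×-≡ (x <? y) (¬? (adjacent? x y)) (x ⟶? z) (y ⟶? z) (twins x y z)) ⟩
    ∑[ x < n ] ∑[ y < n ] ∑[ z < n ] (W x y * E x z + W x y * E y z)
      ≡⟨ nonedgeOutdegrees-sum ⟩
    nonedgeOutdegrees ∎
    where open ≡-Reasoning

  module _ {d : ℕ} (regular : Regular (skeleton D) d) where
    open ≡-Reasoning

    -- Outdegrees and indegrees have the same sum, and at each vertex the two add up to `d`.
    handshake : 2 * sum outdegree ≡ n * d
    handshake = begin
      2 * sum outdegree
        ≡⟨ cong (sum outdegree +_) (+-identityʳ (sum outdegree)) ⟩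
      sum outdegree + sum outdegree
        -- Exchanging the sums turns the second copy into the sum of the indegrees.
        ≡⟨ cong (sum outdegree +_) (∑-comm E) ⟩
      sum outdegree + ∑[ z < n ] ∑[ x < n ] E x z
        ≡⟨ ∑-distrib-+ outdegree (λ z → ∑[ x < n ] E x z) ⟨
      ∑[ x < n ] (∑[ z < n ] E x z + ∑[ z < n ] E z x)
        ≡⟨ (sum-cong-≗ λ x → ∑-distrib-+ (E x) (λ z → E z x)) ⟨
      ∑[ x < n ] ∑[ z < n ] (E x z + E z x)
        -- Opposite edges would form a cycle of length two, so the indicators add.
        ≡⟨ (sum-cong-≗ λ x → sum-cong-≗ λ z → 𝟙-⊎ (x ⟶? z) (z ⟶? x)
              λ (x⟶z , z⟶x) → acyclic x (x⟶z ∷ [ z⟶x ])) ⟨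
      ∑[ x < n ] ∑[ z < n ] 𝟙 (adjacent? x z)
        ≡⟨ sum-cong-≗ regular ⟩
      ∑[ x < n ] d
        ≡⟨ sum-const n d ⟩
      n * d ∎

    -- The outdegree of a vertex is counted once for each of its nonneighbours, and their number is
    -- the same at every vertex.
    nonedgeOutdegrees-factor : nonedgeOutdegrees ≡ (n ∸ suc d) * sum outdegree
    nonedgeOutdegrees-factor = begin
      ∑[ x < n ] ∑[ y < n ] (W x y * outdegree x + W x y * outdegree y)
        ≡⟨ (sum-cong-≗ λ x → ∑-distrib-+ (λ y → W x y * outdegree x) (λ y → W x y * outdegree y)) ⟩
      ∑[ x < n ] (∑[ y < n ] (W x y * outdegree x) + ∑[ y < n ] (W x y * outdegree y))
        ≡⟨ ∑-distrib-+ (λ x → ∑[ y < n ] (W x y * outdegree x))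
                       (λ x → ∑[ y < n ] (W x y * outdegree y)) ⟩
      S + ∑[ x < n ] ∑[ y < n ] (W x y * outdegree y)
        -- Exchanging the roles of `x` and `y` gathers all multiples of `outdegree x` at `x`.
        ≡⟨ cong (S +_) (∑-comm (λ x y → W x y * outdegree y)) ⟩
      S + ∑[ x < n ] ∑[ y < n ] (W y x * outdegree x)
        ≡⟨ ∑-distrib-+ (λ x → ∑[ y < n ] (W x y * outdegree x))
                       (λ x → ∑[ y < n ] (W y x * outdegree x)) ⟨
      ∑[ x < n ] (∑[ y < n ] (W x y * outdegree x) + ∑[ y < n ] (W y x * outdegree x))
        ≡⟨ sum-cong-≗ collect ⟩
      ∑[ x < n ] ((n ∸ suc d) * outdegree x)
        ≡⟨ *-distribˡ-sum (n ∸ suc d) outdegree ⟨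
      (n ∸ suc d) * sum outdegree ∎
      where
      S = ∑[ x < n ] ∑[ y < n ] (W x y * outdegree x)
      collect : ∀ x →
        ∑[ y < n ] (W x y * outdegree x) + ∑[ y < n ] (W y x * outdegree x)
          ≡ (n ∸ suc d) * outdegree x
      collect x = begin
        ∑[ y < n ] (W x y * outdegree x) + ∑[ y < n ] (W y x * outdegree x)
          ≡⟨ cong₂ _+_ (*-distribʳ-sum (outdegree x) (W x))
                       (*-distribʳ-sum (outdegree x) (λ y → W y x)) ⟨
        ∑[ y < n ] W x y * outdegree x + ∑[ y < n ] W y x * outdegree x
          ≡⟨ *-distribʳ-+ (outdegree x) (∑[ y < n ] W x y) (∑[ y < n ] W y x) ⟨
        (∑[ y < n ] W x y + ∑[ y < n ] W y x) * outdegree x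
          ≡⟨ cong (_* outdegree x) (∑-distrib-+ (W x) (λ y → W y x)) ⟨
        ∑[ y < n ] (W x y + W y x) * outdegree x
          ≡⟨ cong (_* outdegree x) (nonneighbours-regular (skeleton D) regular x) ⟩
        (n ∸ suc d) * outdegree x ∎

    -- The right side is free of the orientation. Doubling avoids halving `n * d`.
    2*nonedgeOutdegrees : 2 * nonedgeOutdegrees ≡ (n ∸ suc d) * (n * d)
    2*nonedgeOutdegrees = begin
      2 * nonedgeOutdegrees                ≡⟨ cong (2 *_) nonedgeOutdegrees-factor ⟩
      2 * ((n ∸ suc d) * sum outdegree)    ≡⟨ swap₂ (n ∸ suc d) (sum outdegree) ⟩
      (n ∸ suc d) * (2 * sum outdegree)    ≡⟨ cong ((n ∸ suc d) *_) handshake ⟩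
      (n ∸ suc d) * (n * d)                ∎
      where
      swap₂ : ∀ a b → 2 * (a * b) ≡ a * (2 * b)
      swap₂ = solve-∀

-- Regularity of the complete bipartite graph.

K-regular : ∀ p → Regular K[ p , p ] p
K-regular p x with splitAt p x
... | inj₁ i = begin
  ∑[ y < p + p ] 𝟙 (oppositeParts? {Fin p} {Fin p} (inj₁ i) (splitAt p y))
    ≡⟨ sum-splitAt p (λ t → 𝟙 (oppositeParts? (inj₁ i) t)) ⟩
  ∑[ i < p ] 0 + ∑[ j < p ] 1 ≡⟨ cong₂ _+_ (sum-const p 0) (sum-const p 1) ⟩
  p * 0 + p * 1               ≡⟨ arith p ⟩
  p                           ∎
  where
  open ≡-Reasoning
  arith : ∀ p → p * 0 + p * 1 ≡ p
  arith = solve-∀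
... | inj₂ j = begin
  ∑[ y < p + p ] 𝟙 (oppositeParts? {Fin p} {Fin p} (inj₂ j) (splitAt p y))
    ≡⟨ sum-splitAt p (λ t → 𝟙 (oppositeParts? (inj₂ j) t)) ⟩
  ∑[ i < p ] 1 + ∑[ j < p ] 0 ≡⟨ cong₂ _+_ (sum-const p 1) (sum-const p 0) ⟩
  p * 1 + p * 0               ≡⟨ arith p ⟩
  p                           ∎
  where
  open ≡-Reasoning
  arith : ∀ p → p * 1 + p * 0 ≡ p
  arith = solve-∀

-- The extremal orientation.

LeftToRight : Rel (A ⊎ B) 0ℓ
LeftToRight (inj₁ _) (inj₂ _) = ⊤
LeftToRight (inj₁ _) (inj₁ _) = ⊥
LeftToRight (inj₂ _) _        = ⊥

leftToRight? : Decidable (LeftToRight {A} {B})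
leftToRight? (inj₁ _) (inj₂ _) = yes tt
leftToRight? (inj₁ _) (inj₁ _) = no λ ()
leftToRight? (inj₂ _) _        = no λ ()

leftToRight-irrefl : (s : A ⊎ B) → ¬ LeftToRight s s
leftToRight-irrefl (inj₁ _) ()
leftToRight-irrefl (inj₂ _) ()

-- Vacuous, since no vertex is both a head and a tail. It collapses the transitive closure, so that
-- acyclicity reduces to irreflexivity.
leftToRight-trans : (s t u : A ⊎ B) → LeftToRight s t → LeftToRight t u → LeftToRight s u
leftToRight-trans (inj₁ _) (inj₂ _) _ _ ()

leftToRight-skeleton : (s t : A ⊎ B) → (LeftToRight s t ⊎ LeftToRight t s) ⇔ OppositeParts s t
leftToRight-skeleton (inj₁ _) (inj₁ _) = mk⇔ (λ { (inj₁ ()) ; (inj₂ ()) }) λ ()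
leftToRight-skeleton (inj₁ _) (inj₂ _) = mk⇔ (λ _ → tt) inj₁
leftToRight-skeleton (inj₂ _) (inj₁ _) = mk⇔ (λ _ → tt) inj₂
leftToRight-skeleton (inj₂ _) (inj₂ _) = mk⇔ (λ { (inj₁ ()) ; (inj₂ ()) }) λ ()

-- Nonadjacent vertices lie in the same part: those on the left point to the whole right part, those
-- on the right to nothing.
leftToRight-twins : (s t u : A ⊎ B) → ¬ (LeftToRight s t ⊎ LeftToRight t s) →
                    LeftToRight s u ⇔ LeftToRight t u
leftToRight-twins (inj₁ _) (inj₁ _) (inj₁ _) _ = mk⇔ id id
leftToRight-twins (inj₁ _) (inj₁ _) (inj₂ _) _ = mk⇔ id id
leftToRight-twins (inj₂ _) (inj₂ _) _        _ = mk⇔ id id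
leftToRight-twins (inj₁ _) (inj₂ _) _ nonadj = ⊥-elim (nonadj (inj₁ tt))
leftToRight-twins (inj₂ _) (inj₁ _) _ nonadj = ⊥-elim (nonadj (inj₂ tt))

K-leftToRight : ∀ p q → DAG (p + q)
K-leftToRight p q = record
  { _⟶_     = _⟶_
  ; _⟶?_    = λ x y → leftToRight? (splitAt p x) (splitAt p y)
  ; acyclic = λ x → leftToRight-irrefl (splitAt p x) ∘ collapse
  }
  where
  _⟶_ : Rel (Fin (p + q)) 0ℓ
  x ⟶ y = LeftToRight (splitAt p x) (splitAt p y)
  collapse : ∀ {x y} → TransClosure _⟶_ x y → x ⟶ y
  collapse [ x⟶y ] = x⟶y
  collapse {x} {z} (_∷_ {y = y} x⟶y y⟶⁺z) =
    leftToRight-trans (splitAt p x) (splitAt p y) (splitAt p z) x⟶y (collapse y⟶⁺z)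

-- Binomial arithmetic and the value for the complete bipartite graph.

-- Induction by Pascal's rule; the shifted index avoids a truncated predecessor.
2*[1+n]C2 : ∀ n → 2 * (suc n C 2) ≡ suc n * n
2*[1+n]C2 zero    = refl
2*[1+n]C2 (suc n) = begin
  2 * (suc (suc n) C 2)          ≡⟨ cong (2 *_) (nCk+nC[k+1]≡[n+1]C[k+1] (suc n) 1) ⟨
  2 * (suc n C 1 + suc n C 2)    ≡⟨ cong (λ k → 2 * (k + suc n C 2)) (nC1≡n (suc n)) ⟩
  2 * (suc n + suc n C 2)        ≡⟨ dist (suc n) (suc n C 2) ⟩
  2 * suc n + 2 * (suc n C 2)    ≡⟨ cong (2 * suc n +_) (2*[1+n]C2 n) ⟩
  2 * suc n + suc n * n          ≡⟨ arith n ⟩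
  suc (suc n) * suc n            ∎
  where
  open ≡-Reasoning
  dist : ∀ a b → 2 * (a + b) ≡ 2 * a + 2 * b
  dist = solve-∀
  arith : ∀ n → 2 * suc n + suc n * n ≡ suc (suc n) * suc n
  arith = solve-∀

-- The left side is `(n ∸ suc d) * (n * d)` at `n = p + p` and `d = p`.
K-count : ∀ p → (p + p ∸ suc p) * ((p + p) * p) ≡ 2 * (2 * (p * (p C 2)))
K-count zero    = refl
K-count (suc n) = begin
  -- With `p = suc n`, one successor on each side of the subtraction has cancelled by computation;
  -- the first factor is `p - 1`.
  (n + suc n ∸ suc n) * ((suc n + suc n) * suc n)
    ≡⟨ cong (_* ((suc n + suc n) * suc n)) (m+n∸n≡m n (suc n)) ⟩
  n * ((suc n + suc n) * suc n)                   ≡⟨ regroup n (suc n) ⟩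
  2 * (suc n * (suc n * n))                       ≡⟨ cong (λ k → 2 * (suc n * k)) (2*[1+n]C2 n) ⟨
  2 * (suc n * (2 * (suc n C 2)))                 ≡⟨ pull (suc n) (suc n C 2) ⟩
  2 * (2 * (suc n * (suc n C 2)))                 ∎
  where
  open ≡-Reasoning
  regroup : ∀ a b → a * ((b + b) * b) ≡ 2 * (b * (b * a))
  regroup = solve-∀
  pull : ∀ a b → 2 * (a * (2 * b)) ≡ 2 * (2 * (a * b))
  pull = solve-∀

-- The factor 2 of the handshake identity is cancelled here; the remaining one comes from
-- `2ab ≤ a + b`.
nonedgeOutdegrees-K : ∀ p (D : DAG (p + p)) → skeleton D ≈ᴳ K[ p , p ] →
                      nonedgeOutdegrees D ≡ 2 * (p * (p C 2))
nonedgeOutdegrees-K p D D≈K = *-cancelˡ-≡ _ _ 2 (trans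
  (2*nonedgeOutdegrees D (Regular-resp-≈ᴳ {G = skeleton D} {H = K[ p , p ]} D≈K (K-regular p)))
  (K-count p))

theorem2p10 : (p : ℕ) → ImmoralityNumber K[ p , p ] (p * (p C 2))
theorem2p10 p = (D , D≈K , *-cancelˡ-≡ _ _ 2 attained) , bound
  where
  D : DAG (p + p)
  D = K-leftToRight p p

  D≈K : skeleton D ≈ᴳ K[ p , p ]
  D≈K x y = leftToRight-skeleton (splitAt p x) (splitAt p y)

  attained : 2 * #immoralities D ≡ 2 * (p * (p C 2))
  attained = trans
    (2*#immoralities≡nonedgeOutdegrees D
      λ x y z → leftToRight-twins (splitAt p x) (splitAt p y) (splitAt p z))
    (nonedgeOutdegrees-K p D D≈K)

  bound : ∀ D′ → skeleton D′ ≈ᴳ K[ p , p ] → #immoralities D′ ≤ p * (p C 2)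
  bound D′ D′≈K = *-cancelˡ-≤ 2 (begin
    2 * #immoralities D′  ≤⟨ 2*#immoralities≤nonedgeOutdegrees D′ ⟩
    nonedgeOutdegrees D′  ≡⟨ nonedgeOutdegrees-K p D′ D′≈K ⟩
    2 * (p * (p C 2))     ∎)
    where open ≤-Reasoning
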